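{- Let $k,n\in\mathbb N^+$ and $\mathbf C=(c_0,\dots,c_k)\in\{0,1\}^{k+1}$. For every integer $m\ge c_k-1$, $$O_{\mathbf C}(n+1,m+1)=n^kF_{n+1}(\mathbf C)\,O_{\mathbf C}(n,m)+n^kF_{n+1}(\mathbf C')\,O_{\mathbf C}(n,m+1),$$ and the boundary values are $O_{\mathbf C}(n,m)=0$ whenever $m=c_k-1$ or $m>c_k-1+n$, and $O_{\mathbf C}(1,c_k)=1$.
   Context: Fix integers $k\ge 1$, $n\ge 1$ and a vector $\mathbf C=(c_0,c_1,\dots,c_k)\in\{0,1\}^{k+1}$; put $\mathbf C'=(1,\dots,1)-\mathbf C$. Consider $k$-tuples $(\pi_1,\dots,\pi_k)$ of permutations of $\{1,\dots,n\}$. A position $\alpha\in\{1,\dots,n\}$ is a record of a permutation $\pi$ if $\pi(\alpha)<\pi(\alpha')$ for every $\alpha'<\alpha$ (position $1$ is always a record); equivalently, records index the minimal elements of the points $(\alpha,\pi(\alpha))$ under strict componentwise domination. For a tuple, let $l_\alpha$ be the number of $\beta\in\{1,\dots,k\}$ for which $\alpha$ is a record of $\pi_\beta$ (so $l_1=k$). The $\mathbf C$ sequential optimization set of the tuple is $S=\{\alpha: c_{l_\alpha}=1\}$, with weight $|S|$. For an integer $m$, $O_{\mathbf C}(n,m)$ is the number of $k$-tuples of permutations of $\{1,\dots,n\}$ whose weight equals $m$ (so it is $0$ for $m<0$ or $m>n$). For $j\ge 2$ and $X=(x_0,\dots,x_k)\in\mathbb R^{k+1}$, $F_j(X)=\sum_{\beta=0}^k\binom{k}{\beta}\frac{x_\beta}{(j-1)^\beta}$.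 -}

module Defs where

open import Data.Fin.Base using (Fin; zero; suc; fromℕ; fromℕ<; toℕ; _<_)
open import Data.Fin.Properties using (_≟_; _<?_; all?; any?)
open import Data.Fin.Subset using (Subset; ∣_∣)
open import Data.Integer.Base as ℤ using (ℤ; +_)
import Data.Integer.Properties as ℤ
open import Data.List.Base using (List; []; _∷_; allFin; cartesianProductWith; filter; length)
open import Data.Nat.Base as ℕ using (ℕ; zero; suc; _∸_; _^_; s≤s; NonZero)
open import Data.Nat.Combinatorics using () renaming (_C_ to _choose_)
import Data.Nat.Properties as ℕ
open import Data.Rational.Base as ℚ using (ℚ; 1ℚ; _/_)
open import Data.Rational.Properties using (+-0-commutativeMonoid)
open import Algebra.Properties.CommutativeMonoid.Sum +-0-commutativeMonoid using (sum)
open import Data.Vec.Base using (Vec; []; _∷_; count; lookup; map; replicate; tabulate; zipWith)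
open import Data.Vec.Properties using (count≤n)
open import Function.Base using (_∘_)
open import Function.Consequences.Propositional
  using (strictlySurjective⇒surjective; surjective⇒strictlySurjective)
open import Function.Definitions using (Bijective; Injective; Surjective)
open import Relation.Binary.PropositionalEquality.Core using (_≡_)
open import Relation.Nullary.Decidable using (Dec; does; map′; _×-dec_; _→-dec_)

-- Positions and values 1, …, n are represented by Fin n, that is by 0, …, n-1.
-- Records only depend on the order, so the shift is harmless.  A map is
-- represented by the vector of its values, so that equality of maps is _≡_.

IsPermutation : ∀ {n} → Vec (Fin n) n → Set
IsPermutation π = Bijective _≡_ _≡_ (lookup π)

isPermutation? : ∀ {n} (π : Vec (Fin n) n) → Dec (IsPermutation π)
isPermutation? π = injective? ×-dec surjective?
  where
  injective? : Dec (Injective _≡_ _≡_ (lookup π))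
  injective? = map′ (λ inj {x} {y} → inj x y) (λ inj x y → inj)
    (all? λ x → all? λ y → (lookup π x ≟ lookup π y) →-dec (x ≟ y))

  surjective? : Dec (Surjective _≡_ _≡_ (lookup π))
  surjective? = map′ strictlySurjective⇒surjective surjective⇒strictlySurjective
    (all? λ y → any? λ x → lookup π x ≟ y)

-- Every vector of length k with entries in xs, each exactly once when xs has
-- no repetitions.
vectors : {A : Set} (k : ℕ) → List A → List (Vec A k)
vectors zero    xs = [] ∷ []
vectors (suc k) xs = cartesianProductWith _∷_ xs (vectors k xs)

permutations : (n : ℕ) → List (Vec (Fin n) n)
permutations n = filter isPermutation? (vectors n (allFin n))

tuples : (k n : ℕ) → List (Vec (Vec (Fin n) n) k)
tuples k n = vectors k (permutations n)

IsRecord : ∀ {n} → Fin n → Vec (Fin n) n → Set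
IsRecord α π = ∀ α′ → α′ < α → lookup π α < lookup π α′

isRecord? : ∀ {n} (α : Fin n) (π : Vec (Fin n) n) → Dec (IsRecord α π)
isRecord? α π = all? λ α′ → (α′ <? α) →-dec (lookup π α <? lookup π α′)

-- l_α, as an index into (c₀, …, c_k).
level : ∀ {k n} → Vec (Vec (Fin n) n) k → Fin n → Fin (suc k)
level πs α = fromℕ< (s≤s (count≤n (isRecord? α) πs))

optimizationSet : ∀ {k n} → Vec (Fin 2) (suc k) → Vec (Vec (Fin n) n) k → Subset n
optimizationSet C πs = tabulate λ α → does (lookup C (level πs α) ≟ suc zero)

weight : ∀ {k n} → Vec (Fin 2) (suc k) → Vec (Vec (Fin n) n) k → ℕ
weight C πs = ∣ optimizationSet C πs ∣

O : ∀ {k} → Vec (Fin 2) (suc k) → ℕ → ℤ → ℕ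
O {k} C n m = length (filter (λ πs → + weight C πs ℤ.≟ m) (tuples k n))

lastCoordinate : ∀ {k} → Vec (Fin 2) (suc k) → ℤ
lastCoordinate {k} C = + toℕ (lookup C (fromℕ k))

fromNat : ℕ → ℚ
fromNat i = + i / 1

-- The instance argument says j ≥ 2 (j ∸ 1 is truncated, so it excludes 0 and 1).
F : ∀ {k} (j : ℕ) .{{_ : NonZero (j ∸ 1)}} → Vec ℚ (suc k) → ℚ
F {k} j X = sum term
  where
  term : Fin (suc k) → ℚ
  term β = fromNat (k choose toℕ β) ℚ.* (lookup X β ℚ.* (+ 1 / ((j ∸ 1) ^ toℕ β)))
    where instance _ = ℕ.m^n≢0 (j ∸ 1) (toℕ β)

toRational : ∀ {k} → Vec (Fin 2) k → Vec ℚ k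
toRational = map (fromNat ∘ toℕ)

-- C′ = (1, …, 1) - C.
complement : ∀ {k} → Vec (Fin 2) k → Vec ℚ k
complement C = zipWith ℚ._-_ (replicate _ 1ℚ) (toRational C)

{-# OPTIONS --safe #-}
-- Every permutation of n + 1 positions arises uniquely from a permutation π of n
-- positions and a last value v, by shifting the values ≥ v of π up by one.  Doing
-- so keeps the records of π, and the new last position is a record iff v is
-- minimal.  Hence the last position of an extended k-tuple has level β for
-- (k choose β) n^(k-β) choices of the k last values; summing over the β with
-- c_β = 1, respectively c_β = 0, gives the two coefficients n^k F_{n+1}.  For the
-- boundary values, note that position 1 has level k, so that the weight lies
-- between c_k and c_k + n - 1.
module Submission where

open import Defs
import Algebra.Properties.CommutativeMonoid.Sum as CommutativeMonoidSum
import Algebra.Properties.Semiring.Sum as SemiringSum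
open import Data.Bool.Base using (Bool; true; false; if_then_else_)
open import Data.Fin.Base using (Fin; zero; suc; fromℕ; fromℕ<; inject₁; punchIn; punchOut; toℕ; _<_)
open import Data.Fin.Properties
  using ( _≟_; toℕ-injective; toℕ<n; toℕ≤pred[n]; toℕ-fromℕ; toℕ-fromℕ<; fromℕ<-cong; ≤fromℕ
        ; toℕ-inject₁; inject₁-injective; fromℕ≢inject₁; punchIn-injective; punchInᵢ≢i
        ; punchIn-mono-≤; punchIn-cancel-≤; punchIn-punchOut)
open import Data.Fin.Relation.Unary.Top using (view; ‵fromℕ; ‵inject₁)
open import Data.Fin.Subset using (∣_∣)
open import Data.Fin.Subset.Properties using (∣p∣≤n)
open import Data.Integer.Base as ℤ using (ℤ; +_; 1ℤ)
import Data.Integer.Properties as ℤ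
open import Data.List.Base as List using (List; []; _∷_; allFin; cartesianProductWith; filter; length)
open import Data.List.Membership.Propositional using (_∈_)
open import Data.List.Membership.Propositional.Properties
  using (∈-allFin; ∈-filter⁺; ∈-filter⁻; ∈-cartesianProductWith⁺; ∈-cartesianProductWith⁻)
open import Data.List.Membership.Propositional.Properties.WithK using (unique∧set⇒bag)
import Data.List.Properties as List
open import Data.List.Relation.Binary.BagAndSetEquality using (∼bag⇒↭)
open import Data.List.Relation.Binary.Permutation.Propositional using (_↭_)
import Data.List.Relation.Binary.Permutation.Propositional.Properties as ↭
import Data.List.Relation.Unary.All as All
open import Data.List.Relation.Unary.Any using (here)
open import Data.List.Relation.Unary.Unique.Propositional using (Unique; []; _∷_)
import Data.List.Relation.Unary.Unique.Propositional.Properties as Unique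
open import Data.Nat.Base as ℕ using (ℕ; zero; suc; _+_; _*_; _∸_; _^_; s≤s; z≤n; NonZero)
open import Data.Nat.Combinatorics using (nCk+nC[k+1]≡[n+1]C[k+1]; k>n⇒nCk≡0) renaming (_C_ to _choose_)
open import Data.Nat.ListAction using (sum)
open import Data.Nat.ListAction.Properties using (sum-++; sum-↭)
import Data.Nat.Properties as ℕ
open import Data.Nat.Solver using () renaming (module +-*-Solver to ℕ-Solver)
open import Data.Product.Base using (_×_; _,_; proj₁; proj₂)
open import Data.Rational.Base as ℚ using (ℚ; 1ℚ; _/_; fromℚᵘ; toℚᵘ)
import Data.Rational.Properties as ℚ
open import Data.Rational.Solver using () renaming (module +-*-Solver to ℚ-Solver)
open import Data.Rational.Unnormalised.Base as ℚᵘ using (mkℚᵘ)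
import Data.Rational.Unnormalised.Properties as ℚᵘ
open import Data.Sum.Base using (_⊎_; inj₁; inj₂)
open import Data.Vec.Base using (Vec; []; _∷_; _∷ʳ_; count; lookup; map; tabulate; zipWith)
import Data.Vec.Properties as Vec
import Data.Vec.Relation.Unary.All as VecAll
open import Function.Base using (_∘_)
open import Function.Bundles using (_⇔_; mk⇔)
open import Relation.Binary.PropositionalEquality
  using (_≡_; _≢_; refl; sym; trans; cong; cong₂; subst; subst₂; module ≡-Reasoning)
open import Relation.Nullary.Decidable using (Dec; yes; no; does; does-⇔; dec-true)
open import Relation.Nullary.Negation using (contradiction)
open import Algebra.Properties.AbelianGroup ℤ.+-0-abelianGroup using (∙-cancelʳ)
open import Algebra.Properties.CommutativeSemigroup ℕ.+-commutativeSemigroup using (interchange; x∙yz≈y∙xz)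
open CommutativeMonoidSum ℕ.+-0-commutativeMonoid using (sum-cong-≗; ∑-distrib-+; sum-init-last)
  renaming (sum to ∑)
open CommutativeMonoidSum ℚ.+-0-commutativeMonoid using () renaming (sum to ∑ℚ)
open SemiringSum ℕ.+-*-semiring using (*-distribˡ-sum)

-- Finite sums over lists and over vectors of list entries.

sumOver : {A : Set} → List A → (A → ℕ) → ℕ
sumOver xs f = sum (List.map f xs)

boolToℕ : Bool → ℕ
boolToℕ b = if b then 1 else 0

module _ {A : Set} where

  sumOver-cong : (xs : List A) {f g : A → ℕ} → (∀ x → f x ≡ g x) → sumOver xs f ≡ sumOver xs g
  sumOver-cong xs f≗g = cong sum (List.map-cong f≗g xs)

  sumOver-cong-∈ : (xs : List A) {f g : A → ℕ} → (∀ {x} → x ∈ xs → f x ≡ g x) →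
    sumOver xs f ≡ sumOver xs g
  sumOver-cong-∈ xs f≗g = cong sum (List.map-cong-local (All.tabulate f≗g))

  sumOver-+ : (xs : List A) (f g : A → ℕ) →
    sumOver xs (λ x → f x + g x) ≡ sumOver xs f + sumOver xs g
  sumOver-+ []       f g = refl
  sumOver-+ (x ∷ xs) f g = begin
    f x + g x + sumOver xs (λ x → f x + g x)  ≡⟨ cong (f x + g x ℕ.+_) (sumOver-+ xs f g) ⟩
    f x + g x + (sumOver xs f + sumOver xs g) ≡⟨ interchange (f x) (g x) _ _ ⟩
    f x + sumOver xs f + (g x + sumOver xs g) ∎
    where open ≡-Reasoning

  sumOver-*ˡ : (xs : List A) (a : ℕ) (f : A → ℕ) → sumOver xs (λ x → a * f x) ≡ a * sumOver xs f
  sumOver-*ˡ []       a f = sym (ℕ.*-zeroʳ a)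
  sumOver-*ˡ (x ∷ xs) a f = begin
    a * f x + sumOver xs (λ x → a * f x) ≡⟨ cong (a * f x ℕ.+_) (sumOver-*ˡ xs a f) ⟩
    a * f x + a * sumOver xs f           ≡⟨ ℕ.*-distribˡ-+ a (f x) _ ⟨
    a * (f x + sumOver xs f)             ∎
    where open ≡-Reasoning

  sumOver-0 : (xs : List A) → sumOver xs (λ _ → 0) ≡ 0
  sumOver-0 []       = refl
  sumOver-0 (_ ∷ xs) = sumOver-0 xs

  sumOver-↭ : {xs ys : List A} → xs ↭ ys → (f : A → ℕ) → sumOver xs f ≡ sumOver ys f
  sumOver-↭ xs↭ys f = sum-↭ (↭.map⁺ f xs↭ys)

  sumOver-tabulate-const : (n : ℕ) (g : Fin n → A) (f : A → ℕ) (a : ℕ) →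
    (∀ i → f (g i) ≡ a) → sumOver (List.tabulate g) f ≡ n * a
  sumOver-tabulate-const zero    g f a eq = refl
  sumOver-tabulate-const (suc n) g f a eq =
    cong₂ _+_ (eq zero) (sumOver-tabulate-const n (g ∘ suc) f a (eq ∘ suc))

  length-filter≡sumOver : {P : A → Set} (P? : ∀ x → Dec (P x)) (xs : List A) →
    length (filter P? xs) ≡ sumOver xs (boolToℕ ∘ does ∘ P?)
  length-filter≡sumOver P? []       = refl
  length-filter≡sumOver P? (x ∷ xs) with does (P? x)
  ... | true  = cong suc (length-filter≡sumOver P? xs)
  ... | false = length-filter≡sumOver P? xs

sumOver-comm : {A B : Set} (xs : List A) (ys : List B) (f : A → B → ℕ) →
  sumOver xs (λ x → sumOver ys (f x)) ≡ sumOver ys (λ y → sumOver xs (λ x → f x y))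
sumOver-comm []       ys f = sym (sumOver-0 ys)
sumOver-comm (x ∷ xs) ys f = begin
  sumOver ys (f x) + sumOver xs (λ x → sumOver ys (f x))
    ≡⟨ cong (sumOver ys (f x) ℕ.+_) (sumOver-comm xs ys f) ⟩
  sumOver ys (f x) + sumOver ys (λ y → sumOver xs (λ x → f x y))
    ≡⟨ sumOver-+ ys (f x) _ ⟨
  sumOver ys (λ y → f x y + sumOver xs (λ x → f x y)) ∎
  where open ≡-Reasoning

sumOver-product : {A B C : Set} (_∙_ : A → B → C) (xs : List A) (ys : List B) (f : C → ℕ) →
  sumOver (cartesianProductWith _∙_ xs ys) f ≡ sumOver xs (λ x → sumOver ys (λ y → f (x ∙ y)))
sumOver-product _∙_ []       ys f = refl
sumOver-product _∙_ (x ∷ xs) ys f = begin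
  sum (List.map f (List.map (x ∙_) ys List.++ cartesianProductWith _∙_ xs ys))
    ≡⟨ cong sum (List.map-++ f (List.map (x ∙_) ys) _) ⟩
  sum (List.map f (List.map (x ∙_) ys) List.++ List.map f (cartesianProductWith _∙_ xs ys))
    ≡⟨ sum-++ (List.map f (List.map (x ∙_) ys)) _ ⟩
  sum (List.map f (List.map (x ∙_) ys)) + sumOver (cartesianProductWith _∙_ xs ys) f
    ≡⟨ cong₂ _+_ (cong sum (sym (List.map-∘ ys))) (sumOver-product _∙_ xs ys f) ⟩
  sumOver ys (λ y → f (x ∙ y)) + sumOver xs (λ x → sumOver ys (λ y → f (x ∙ y))) ∎
  where open ≡-Reasoning

-- This lifts a parametrisation of single entries by pairs to k-tuples: a tuple of extended
-- permutations becomes a tuple of permutations together with a tuple of last values. The order of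
-- `zs` is irrelevant to a sum, so `_↭_` suffices.
sumOver-vectors-zipWith : {A B C : Set} (_∙_ : A → B → C) (xs : List A) (ys : List B) (zs : List C) →
  zs ↭ cartesianProductWith _∙_ xs ys → (k : ℕ) (f : Vec C k → ℕ) →
  sumOver (vectors k zs) f
    ≡ sumOver (vectors k xs) (λ us → sumOver (vectors k ys) (λ vs → f (zipWith _∙_ us vs)))
sumOver-vectors-zipWith _∙_ xs ys zs zs↭ zero    f = sym (ℕ.+-identityʳ _)
sumOver-vectors-zipWith _∙_ xs ys zs zs↭ (suc k) f = begin
  sumOver (vectors (suc k) zs) f
    ≡⟨ sumOver-product _∷_ zs (vectors k zs) f ⟩
  sumOver zs (λ z → sumOver (vectors k zs) (λ ws → f (z ∷ ws)))
    ≡⟨ sumOver-↭ zs↭ _ ⟩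
  sumOver (cartesianProductWith _∙_ xs ys) (λ z → sumOver (vectors k zs) (λ ws → f (z ∷ ws)))
    ≡⟨ sumOver-product _∙_ xs ys _ ⟩
  sumOver xs (λ x → sumOver ys λ y → sumOver (vectors k zs) (λ ws → f ((x ∙ y) ∷ ws)))
    ≡⟨ sumOver-cong xs (λ x → sumOver-cong ys λ y →
         sumOver-vectors-zipWith _∙_ xs ys zs zs↭ k (λ ws → f ((x ∙ y) ∷ ws))) ⟩
  sumOver xs (λ x → sumOver ys λ y → sumOver (vectors k xs) λ us → sumOver (vectors k ys) λ vs →
    f (zipWith _∙_ (x ∷ us) (y ∷ vs)))
    -- The sum over `y` moves inside the sum over `us`, so that `y` can be joined with `vs` into one
    -- vector and `x` with `us` into another.
    ≡⟨ sumOver-cong xs (λ x → sumOver-comm ys (vectors k xs) _) ⟩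
  sumOver xs (λ x → sumOver (vectors k xs) λ us → sumOver ys λ y → sumOver (vectors k ys) λ vs →
    f (zipWith _∙_ (x ∷ us) (y ∷ vs)))
    ≡⟨ sumOver-cong xs (λ x → sumOver-cong (vectors k xs) λ us →
         sumOver-product _∷_ ys (vectors k ys) _) ⟨
  sumOver xs (λ x → sumOver (vectors k xs) λ us → sumOver (vectors (suc k) ys) λ vs →
    f (zipWith _∙_ (x ∷ us) vs))
    ≡⟨ sumOver-product _∷_ xs (vectors k xs) _ ⟨
  sumOver (vectors (suc k) xs) (λ us → sumOver (vectors (suc k) ys) λ vs → f (zipWith _∙_ us vs)) ∎
  where open ≡-Reasoning

-- Permutations

vectors-unique : {A : Set} {xs : List A} (k : ℕ) → Unique xs → Unique (vectors k xs)
vectors-unique zero    xs! = All.[] ∷ []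
vectors-unique (suc k) xs! = Unique.cartesianProductWith⁺ _∷_ Vec.∷-injective xs! (vectors-unique k xs!)

∈-vectors-allFin : ∀ {n k} (v : Vec (Fin n) k) → v ∈ vectors k (allFin n)
∈-vectors-allFin []      = here refl
∈-vectors-allFin (i ∷ v) = ∈-cartesianProductWith⁺ _∷_ (∈-allFin i) (∈-vectors-allFin v)

∈-vectors⁻ : {A : Set} {xs : List A} (k : ℕ) {v : Vec A k} → v ∈ vectors k xs → VecAll.All (_∈ xs) v
∈-vectors⁻ zero {[]} _ = VecAll.[]
∈-vectors⁻ {xs = xs} (suc k) v∈
  with x , v , x∈ , v∈ , refl ← ∈-cartesianProductWith⁻ _∷_ xs (vectors k xs) v∈ = x∈ VecAll.∷ ∈-vectors⁻ k v∈

permutations-unique : ∀ n → Unique (permutations n)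
permutations-unique n = Unique.filter⁺ isPermutation? (vectors-unique n (Unique.allFin⁺ n))

∈-permutations⁺ : ∀ {n} {π : Vec (Fin n) n} → IsPermutation π → π ∈ permutations n
∈-permutations⁺ {π = π} = ∈-filter⁺ isPermutation? (∈-vectors-allFin π)

∈-permutations⁻ : ∀ {n} {π : Vec (Fin n) n} → π ∈ permutations n → IsPermutation π
∈-permutations⁻ {n} = proj₂ ∘ ∈-filter⁻ isPermutation? {xs = vectors n (allFin n)}

module _ {A : Set} where

  lookup-∷ʳ-inject₁ : ∀ {n} (xs : Vec A n) (x : A) (i : Fin n) →
    lookup (xs ∷ʳ x) (inject₁ i) ≡ lookup xs i
  lookup-∷ʳ-inject₁ (_ ∷ _)  x zero    = refl
  lookup-∷ʳ-inject₁ (_ ∷ xs) x (suc i) = lookup-∷ʳ-inject₁ xs x i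

  lookup-∷ʳ-fromℕ : ∀ {n} (xs : Vec A n) (x : A) → lookup (xs ∷ʳ x) (fromℕ n) ≡ x
  lookup-∷ʳ-fromℕ []       x = refl
  lookup-∷ʳ-fromℕ (_ ∷ xs) x = lookup-∷ʳ-fromℕ xs x

  vec-ext : ∀ {n} {xs ys : Vec A n} → (∀ i → lookup xs i ≡ lookup ys i) → xs ≡ ys
  vec-ext {xs = xs} {ys} eq = begin
    xs                   ≡⟨ Vec.tabulate∘lookup xs ⟨
    tabulate (lookup xs) ≡⟨ Vec.tabulate-cong eq ⟩
    tabulate (lookup ys) ≡⟨ Vec.tabulate∘lookup ys ⟩
    ys                   ∎
    where open ≡-Reasoning

extend : ∀ {n} → Vec (Fin n) n → Fin (suc n) → Vec (Fin (suc n)) (suc n)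
extend π v = map (punchIn v) π ∷ʳ v

module _ {n} (π : Vec (Fin n) n) (v : Fin (suc n)) where

  lookup-extend-inject₁ : ∀ i → lookup (extend π v) (inject₁ i) ≡ punchIn v (lookup π i)
  lookup-extend-inject₁ i =
    trans (lookup-∷ʳ-inject₁ (map (punchIn v) π) v i) (Vec.lookup-map i (punchIn v) π)

  lookup-extend-fromℕ : lookup (extend π v) (fromℕ n) ≡ v
  lookup-extend-fromℕ = lookup-∷ʳ-fromℕ (map (punchIn v) π) v

-- The last entry reveals the inserted value; once it is known, `punchIn` of it can be undone entry
-- by entry.
extend-injective : ∀ {n} {π ρ : Vec (Fin n) n} {v w} → extend π v ≡ extend ρ w → π ≡ ρ × v ≡ w
extend-injective {π = π} {ρ} {v} {w} eq with refl ← Vec.∷ʳ-injectiveʳ (map (punchIn v) π) (map (punchIn w) ρ) eq =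
  vec-ext (λ i → punchIn-injective v _ _ (begin
    punchIn v (lookup π i)          ≡⟨ lookup-extend-inject₁ π v i ⟨
    lookup (extend π v) (inject₁ i) ≡⟨ cong (λ σ → lookup σ (inject₁ i)) eq ⟩
    lookup (extend ρ v) (inject₁ i) ≡⟨ lookup-extend-inject₁ ρ v i ⟩
    punchIn v (lookup ρ i)          ∎)) , refl
  where open ≡-Reasoning

extend-isPermutation : ∀ {n} {π : Vec (Fin n) n} v → IsPermutation π → IsPermutation (extend π v)
extend-isPermutation {n} {π} v (π-inj , π-surj) =
  (λ {i} {j} → injective i j) , λ y → surjective y
  where
  injective : ∀ i j → lookup (extend π v) i ≡ lookup (extend π v) j → i ≡ j
  injective i j eq with view i | view j
  ... | ‵fromℕ     | ‵fromℕ     = refl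
  ... | ‵fromℕ     | ‵inject₁ j = contradiction
    (trans (sym (lookup-extend-inject₁ π v j)) (trans (sym eq) (lookup-extend-fromℕ π v)))
    (punchInᵢ≢i v _)
  ... | ‵inject₁ i | ‵fromℕ     = contradiction
    (trans (sym (lookup-extend-inject₁ π v i)) (trans eq (lookup-extend-fromℕ π v)))
    (punchInᵢ≢i v _)
  ... | ‵inject₁ i | ‵inject₁ j = cong inject₁ (π-inj (punchIn-injective v _ _
    (trans (sym (lookup-extend-inject₁ π v i)) (trans eq (lookup-extend-inject₁ π v j)))))

  surjective : ∀ y → _
  surjective y with v ≟ y
  -- The value `v` is taken at the last position; any other `y` is first lowered by `punchOut` and
  -- then found in `π`.
  ... | yes refl = fromℕ n , λ { refl → lookup-extend-fromℕ π v }
  ... | no v≢y with i , eq ← π-surj (punchOut v≢y) = inject₁ i , λ { refl → begin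
    lookup (extend π v) (inject₁ i) ≡⟨ lookup-extend-inject₁ π v i ⟩
    punchIn v (lookup π i)          ≡⟨ cong (punchIn v) (eq refl) ⟩
    punchIn v (punchOut v≢y)        ≡⟨ punchIn-punchOut v≢y ⟩
    y                               ∎ }
    where open ≡-Reasoning

module _ {n} (σ : Vec (Fin (suc n)) (suc n)) (σ-perm : IsPermutation σ) where

  private
    lastValue : Fin (suc n)
    lastValue = lookup σ (fromℕ n)

    lastValue≢ : ∀ i → lastValue ≢ lookup σ (inject₁ i)
    lastValue≢ i eq = fromℕ≢inject₁ (proj₁ σ-perm eq)

  -- The inverse of `extend`: deleting the last value leaves a gap, which `punchOut` closes.
  -- Injectivity of `σ` ensures that no earlier entry equals the deleted value.
  restrict : Vec (Fin n) n
  restrict = tabulate λ i → punchOut (lastValue≢ i)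

  punchIn-restrict : ∀ i → punchIn lastValue (lookup restrict i) ≡ lookup σ (inject₁ i)
  punchIn-restrict i = trans (cong (punchIn lastValue) (Vec.lookup∘tabulate _ i)) (punchIn-punchOut _)

  extend-restrict : extend restrict (lookup σ (fromℕ n)) ≡ σ
  extend-restrict = vec-ext helper
    where
    helper : ∀ i → lookup (extend restrict lastValue) i ≡ lookup σ i
    helper i with view i
    ... | ‵fromℕ     = lookup-extend-fromℕ restrict lastValue
    ... | ‵inject₁ i = trans (lookup-extend-inject₁ restrict lastValue i) (punchIn-restrict i)

  restrict-isPermutation : IsPermutation restrict
  restrict-isPermutation = injective , surjective
    where
    injective : ∀ {i j} → lookup restrict i ≡ lookup restrict j → i ≡ j
    injective {i} {j} eq = inject₁-injective (proj₁ σ-perm (begin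
      lookup σ (inject₁ i)                   ≡⟨ punchIn-restrict i ⟨
      punchIn lastValue (lookup restrict i)  ≡⟨ cong (punchIn lastValue) eq ⟩
      punchIn lastValue (lookup restrict j)  ≡⟨ punchIn-restrict j ⟩
      lookup σ (inject₁ j)                   ∎))
      where open ≡-Reasoning

    surjective : ∀ y → _
    surjective y with i , eq ← proj₂ σ-perm (punchIn lastValue y) | view i
    -- A preimage of `punchIn lastValue y` is never the last position, because `punchIn lastValue`
    -- avoids `lastValue`.
    ... | ‵fromℕ     = contradiction (sym (eq refl)) (punchInᵢ≢i lastValue y)
    ... | ‵inject₁ i = i , λ { refl → punchIn-injective lastValue _ _ (trans (punchIn-restrict i) (eq refl)) }

-- Both lists are free of repetitions and have the same members, by `extend` and `restrict`, so they
-- agree up to order.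
permutations-suc-↭ : ∀ n →
  permutations (suc n) ↭ cartesianProductWith extend (permutations n) (allFin (suc n))
permutations-suc-↭ n = ∼bag⇒↭ (unique∧set⇒bag (permutations-unique (suc n))
  (Unique.cartesianProductWith⁺ extend extend-injective (permutations-unique n) (Unique.allFin⁺ (suc n)))
  (mk⇔ to from))
  where
  to : ∀ {σ} → σ ∈ permutations (suc n) → σ ∈ cartesianProductWith extend (permutations n) (allFin (suc n))
  to {σ} σ∈ = subst (_∈ _) (extend-restrict σ σ-perm)
    (∈-cartesianProductWith⁺ extend (∈-permutations⁺ (restrict-isPermutation σ σ-perm)) (∈-allFin _))
    where σ-perm = ∈-permutations⁻ σ∈

  from : ∀ {σ} → σ ∈ cartesianProductWith extend (permutations n) (allFin (suc n)) → σ ∈ permutations (suc n)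
  from σ∈ with π , v , π∈ , _ , refl ← ∈-cartesianProductWith⁻ extend (permutations n) (allFin (suc n)) σ∈ =
    ∈-permutations⁺ (extend-isPermutation {π = π} v (∈-permutations⁻ π∈))

-- Records of an extended permutation

-- `punchIn v` preserves and reflects the order of values, and being a record is tested against
-- earlier positions only, where the new last position does not occur. The lemmas on `punchIn`
-- concern `≤`, so strict inequalities pass through their contrapositives.
isRecord-extend-inject₁ : ∀ {n} (π : Vec (Fin n) n) v α →
  IsRecord (inject₁ α) (extend π v) ⇔ IsRecord α π
isRecord-extend-inject₁ {n} π v α = mk⇔ to from
  where
  to : IsRecord (inject₁ α) (extend π v) → IsRecord α π
  to rec α′ α′<α = ℕ.≰⇒> λ πα′≤πα → ℕ.<⇒≱
    (subst₂ _<_ (lookup-extend-inject₁ π v α) (lookup-extend-inject₁ π v α′)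
      (rec (inject₁ α′) (subst₂ ℕ._<_ (sym (toℕ-inject₁ α′)) (sym (toℕ-inject₁ α)) α′<α)))
    (punchIn-mono-≤ v _ _ πα′≤πα)

  from : IsRecord α π → IsRecord (inject₁ α) (extend π v)
  from rec α′ α′<α with view α′
  ... | ‵fromℕ      = contradiction (≤fromℕ (inject₁ α)) (ℕ.<⇒≱ α′<α)
  ... | ‵inject₁ α′ = subst₂ _<_ (sym (lookup-extend-inject₁ π v α)) (sym (lookup-extend-inject₁ π v α′))
    (ℕ.≰⇒> λ le → ℕ.<⇒≱
      (rec α′ (subst₂ ℕ._<_ (toℕ-inject₁ α′) (toℕ-inject₁ α) α′<α))
      (punchIn-cancel-≤ v _ _ le))

-- If `v` is not zero, then zero is still taken at an earlier position, since `π` is onto and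
-- `punchIn v` fixes zero. If `v` is zero, all earlier values are raised above it.
isRecord-extend-fromℕ : ∀ {n} {π : Vec (Fin n) n} → IsPermutation π → ∀ v →
  IsRecord (fromℕ n) (extend π v) ⇔ v ≡ zero
isRecord-extend-fromℕ {n} {π} (_ , π-surj) v = mk⇔ (to v) from
  where
  to : ∀ v → IsRecord (fromℕ n) (extend π v) → v ≡ zero
  to zero            _   = refl
  -- Matching the implicit argument exposes `n` as a successor, so that `π` has a value zero and
  -- `punchIn v zero` computes to `zero`. The record property then yields the absurd `v < zero`.
  to v@(suc {suc _} _) rec with i , eq ← π-surj zero = contradiction
    (subst₂ _<_ (lookup-extend-fromℕ π v)
      (trans (lookup-extend-inject₁ π v i) (cong (punchIn v) (eq refl)))
      (rec (inject₁ i) (subst₂ ℕ._<_ (sym (toℕ-inject₁ i)) (sym (toℕ-fromℕ n)) (toℕ<n i))))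
    λ ()

  from : v ≡ zero → IsRecord (fromℕ n) (extend π v)
  from refl α′ α′<n with view α′
  ... | ‵fromℕ      = contradiction α′<n (ℕ.<-irrefl refl)
  ... | ‵inject₁ α′ = subst₂ _<_ (sym (lookup-extend-fromℕ π zero)) (sym (lookup-extend-inject₁ π zero α′))
    (s≤s z≤n)

module _ {A B C : Set} {P : C → Set} {Q : A → Set} (P? : ∀ x → Dec (P x)) (Q? : ∀ x → Dec (Q x)) where

  -- For the old positions: whether they are records depends only on the permutation that is
  -- extended.
  count-zipWithˡ : (f : A → B → C) → (∀ x y → P (f x y) ⇔ Q x) →
    ∀ {k} (xs : Vec A k) (ys : Vec B k) → count P? (zipWith f xs ys) ≡ count Q? xs
  count-zipWithˡ f P⇔Q []       []       = refl
  count-zipWithˡ f P⇔Q (x ∷ xs) (y ∷ ys)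
    rewrite does-⇔ (P⇔Q x y) (P? (f x y)) (Q? x) | count-zipWithˡ f P⇔Q xs ys = refl

  -- For the last position: whether it is a record depends only on the last value, provided that the
  -- extended vector is a permutation, which is the role of `R`.
  count-zipWithʳ : (f : B → A → C) {R : B → Set} → (∀ {x} → R x → ∀ y → P (f x y) ⇔ Q y) →
    ∀ {k} {xs : Vec B k} → VecAll.All R xs → (ys : Vec A k) →
    count P? (zipWith f xs ys) ≡ count Q? ys
  count-zipWithʳ f P⇔Q VecAll.[]           []       = refl
  count-zipWithʳ f P⇔Q (Rx VecAll.∷ Rxs) (y ∷ ys)
    rewrite does-⇔ (P⇔Q Rx y) (P? _) (Q? y) | count-zipWithʳ f P⇔Q Rxs ys = refl

-- The level of the new last position, read off from the last values. It is built in the same way as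
-- `level`, so that comparing the two reduces to comparing counts.
zeros : ∀ {n k} → Vec (Fin (suc n)) k → Fin (suc k)
zeros vs = fromℕ< (s≤s (Vec.count≤n (_≟ zero) vs))

level-extend-inject₁ : ∀ {n k} (πs : Vec (Vec (Fin n) n) k) vs α →
  level (zipWith extend πs vs) (inject₁ α) ≡ level πs α
level-extend-inject₁ πs vs α = fromℕ<-cong _ _
  (count-zipWithˡ (isRecord? (inject₁ α)) (isRecord? α) extend
    (λ π v → isRecord-extend-inject₁ π v α) πs vs) _ _

level-extend-fromℕ : ∀ {n k} {πs : Vec (Vec (Fin n) n) k} → VecAll.All IsPermutation πs → ∀ vs →
  level (zipWith extend πs vs) (fromℕ n) ≡ zeros vs
level-extend-fromℕ {n} πs-perm vs = fromℕ<-cong _ _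
  (count-zipWithʳ (isRecord? (fromℕ n)) (_≟ zero) extend (λ {π} → isRecord-extend-fromℕ {π = π}) πs-perm vs) _ _

-- Weights

∣∷∣ : ∀ {n} b (p : Vec Bool n) → ∣ b ∷ p ∣ ≡ boolToℕ b + ∣ p ∣
∣∷∣ false p = refl
∣∷∣ true  p = refl

-- Cardinality is computed from the front, whereas `extend` adds a position at the back.
∣tabulate∣-last : ∀ {n} (f : Fin (suc n) → Bool) →
  ∣ tabulate f ∣ ≡ ∣ tabulate (f ∘ inject₁) ∣ + boolToℕ (f (fromℕ n))
∣tabulate∣-last {zero}  f = trans (∣∷∣ (f zero) []) (ℕ.+-comm _ 0)
∣tabulate∣-last {suc n} f = begin
  ∣ tabulate f ∣                                     ≡⟨ ∣∷∣ (f zero) (tabulate (f ∘ suc)) ⟩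
  boolToℕ (f zero) + ∣ tabulate (f ∘ suc) ∣
    ≡⟨ cong (boolToℕ (f zero) ℕ.+_) (∣tabulate∣-last (f ∘ suc)) ⟩
  boolToℕ (f zero) + (∣ tabulate (f ∘ suc ∘ inject₁) ∣ + boolToℕ (f (fromℕ (suc n))))
    ≡⟨ ℕ.+-assoc (boolToℕ (f zero)) _ _ ⟨
  boolToℕ (f zero) + ∣ tabulate (f ∘ suc ∘ inject₁) ∣ + boolToℕ (f (fromℕ (suc n)))
    ≡⟨ cong (_+ boolToℕ (f (fromℕ (suc n)))) (∣∷∣ (f zero) (tabulate (f ∘ suc ∘ inject₁))) ⟨
  ∣ tabulate (f ∘ inject₁) ∣ + boolToℕ (f (fromℕ (suc n))) ∎
  where open ≡-Reasoning

boolToℕ-≟1 : (c : Fin 2) → boolToℕ (does (c ≟ suc zero)) ≡ toℕ c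
boolToℕ-≟1 zero       = refl
boolToℕ-≟1 (suc zero) = refl

weight-extend : ∀ {n k} (C : Vec (Fin 2) (suc k)) {πs : Vec (Vec (Fin n) n) k} →
  VecAll.All IsPermutation πs → ∀ vs →
  weight C (zipWith extend πs vs) ≡ weight C πs + toℕ (lookup C (zeros vs))
weight-extend {n} C {πs} πs-perm vs = begin
  weight C (zipWith extend πs vs)
    ≡⟨ ∣tabulate∣-last (λ α → chosen (level (zipWith extend πs vs) α)) ⟩
  ∣ tabulate (λ α → chosen (level (zipWith extend πs vs) (inject₁ α))) ∣
    + boolToℕ (chosen (level (zipWith extend πs vs) (fromℕ n)))
    ≡⟨ cong₂ _+_
         (cong ∣_∣ (Vec.tabulate-cong λ α → cong chosen (level-extend-inject₁ πs vs α)))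
         (cong (boolToℕ ∘ chosen) (level-extend-fromℕ πs-perm vs)) ⟩
  weight C πs + boolToℕ (chosen (zeros vs))
    ≡⟨ cong (weight C πs ℕ.+_) (boolToℕ-≟1 _) ⟩
  weight C πs + toℕ (lookup C (zeros vs)) ∎
  where
  open ≡-Reasoning
  chosen : Fin _ → Bool
  chosen β = does (lookup C β ≟ suc zero)

module _ {n k} (C : Vec (Fin 2) (suc k)) (πs : Vec (Vec (Fin (suc n)) (suc n)) k) where

  private
    rest : Vec Bool n
    rest = tabulate λ α → does (lookup C (level πs (suc α)) ≟ suc zero)

  level-zero : level πs zero ≡ fromℕ k
  level-zero = toℕ-injective (begin
    toℕ (level πs zero)        ≡⟨ toℕ-fromℕ< _ ⟩
    count (isRecord? zero) πs  ≡⟨ count-zero πs ⟩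
    k                          ≡⟨ toℕ-fromℕ k ⟨
    toℕ (fromℕ k)              ∎)
    where
    open ≡-Reasoning
    count-zero : ∀ {k} (πs : Vec (Vec (Fin (suc n)) (suc n)) k) → count (isRecord? zero) πs ≡ k
    count-zero []       = refl
    -- No position precedes the first one, so the record condition there is vacuous.
    count-zero (π ∷ πs) rewrite dec-true (isRecord? zero π) (λ _ ()) = cong suc (count-zero πs)

  -- The first position has level k and contributes exactly c_k. The other n positions contribute
  -- between 0 and n, which gives the two bounds below.
  weight-first : weight C πs ≡ toℕ (lookup C (fromℕ k)) + ∣ rest ∣
  weight-first = trans (∣∷∣ _ rest) (cong (_+ ∣ rest ∣)
    (trans (boolToℕ-≟1 (lookup C (level πs zero))) (cong (toℕ ∘ lookup C) level-zero)))

  weight-≥ : toℕ (lookup C (fromℕ k)) ℕ.≤ weight C πs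
  weight-≥ = subst (_ ℕ.≤_) (sym weight-first) (ℕ.m≤m+n _ _)

  weight-≤ : weight C πs ℕ.≤ toℕ (lookup C (fromℕ k)) + n
  weight-≤ = subst (ℕ._≤ _) (sym weight-first) (ℕ.+-monoʳ-≤ _ (∣p∣≤n rest))

-- The number of k-tuples of last values with a given number of zeros

binomialSum : ∀ {k} → ℕ → (Fin (suc k) → ℕ) → ℕ
binomialSum {k} n h = ∑ {suc k} λ β → (k choose toℕ β) * (n ^ (k ∸ toℕ β) * h β)

-- The recursion obtained by splitting off one last value: if it is zero the level rises by one, and
-- otherwise there are n choices and the level stays. It rests on Pascal's rule.
binomialSum-suc : ∀ {k} n (h : Fin (suc (suc k)) → ℕ) →
  binomialSum n h ≡ binomialSum n (h ∘ suc) + n * binomialSum n (h ∘ inject₁)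
binomialSum-suc {k} n h = begin
  (suc k choose 0) * (n ^ suc k * h zero)
    + ∑ {suc k} (λ β → (suc k choose suc (toℕ β)) * (n ^ (k ∸ toℕ β) * h (suc β)))
    -- The term β = 0 agrees with `tail zero` by computation; Pascal's rule is applied to the
    -- remaining terms only.
    ≡⟨ cong (tail zero ℕ.+_)
         (trans (sum-cong-≗ {suc k} λ β → trans
             (cong (_* (n ^ (k ∸ toℕ β) * h (suc β))) (sym (nCk+nC[k+1]≡[n+1]C[k+1] k (toℕ β))))
             (ℕ.*-distribʳ-+ (n ^ (k ∸ toℕ β) * h (suc β)) (k choose toℕ β) _))
           (∑-distrib-+ {suc k} (λ β → (k choose toℕ β) * (n ^ (k ∸ toℕ β) * h (suc β))) (tail ∘ suc))) ⟩
  tail zero + (binomialSum n (h ∘ suc) + ∑ {suc k} (tail ∘ suc))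
    ≡⟨ x∙yz≈y∙xz (tail zero) (binomialSum n (h ∘ suc)) _ ⟩
  binomialSum n (h ∘ suc) + ∑ {suc (suc k)} tail
    ≡⟨ cong (binomialSum n (h ∘ suc) ℕ.+_) (begin
      ∑ {suc (suc k)} tail
        ≡⟨ sum-init-last {suc k} tail ⟩
      ∑ {suc k} (tail ∘ inject₁) + tail (fromℕ (suc k))
        ≡⟨ cong₂ _+_ (sum-cong-≗ {suc k} tail-inject₁) tail-last ⟩
      ∑ {suc k} (λ β → n * ((k choose toℕ β) * (n ^ (k ∸ toℕ β) * h (inject₁ β)))) + 0
        ≡⟨ ℕ.+-identityʳ _ ⟩
      ∑ {suc k} (λ β → n * ((k choose toℕ β) * (n ^ (k ∸ toℕ β) * h (inject₁ β))))
        ≡⟨ *-distribˡ-sum {suc k} n (λ β → (k choose toℕ β) * (n ^ (k ∸ toℕ β) * h (inject₁ β))) ⟨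
      n * binomialSum n (h ∘ inject₁) ∎) ⟩
  binomialSum n (h ∘ suc) + n * binomialSum n (h ∘ inject₁) ∎
  where
  open ≡-Reasoning

  -- After Pascal's rule the terms C(k, β+1) and the term β = 0 together form this
  -- sum up to β = k + 1, whose last term vanishes.
  tail : Fin (suc (suc k)) → ℕ
  tail β = (k choose toℕ β) * (n ^ (suc k ∸ toℕ β) * h β)

  tail-last : tail (fromℕ (suc k)) ≡ 0
  tail-last = cong (_* (n ^ (suc k ∸ toℕ (fromℕ (suc k))) * h (fromℕ (suc k))))
    (trans (cong (k choose_) (toℕ-fromℕ (suc k))) (k>n⇒nCk≡0 (ℕ.n<1+n k)))

  tail-inject₁ : ∀ β → tail (inject₁ β) ≡ n * ((k choose toℕ β) * (n ^ (k ∸ toℕ β) * h (inject₁ β)))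
  -- As β ≤ k, the exponent k + 1 - β is the successor of k - β, which releases the factor `n`.
  tail-inject₁ β rewrite toℕ-inject₁ β | ℕ.+-∸-assoc 1 (toℕ≤pred[n] β) =
    ℕ-Solver.solve 4 (λ n c p h → c :* ((n :* p) :* h) := n :* (c :* (p :* h))) refl
      n (k choose toℕ β) (n ^ (k ∸ toℕ β)) (h (inject₁ β))
    where open ℕ-Solver

zeros-suc : ∀ {n k} (i : Fin n) (vs : Vec (Fin (suc n)) k) → zeros (suc i ∷ vs) ≡ inject₁ (zeros vs)
zeros-suc i vs = toℕ-injective (begin
  toℕ (zeros (suc i ∷ vs))   ≡⟨ toℕ-fromℕ< _ ⟩
  count (_≟ zero) vs         ≡⟨ toℕ-fromℕ< (s≤s (Vec.count≤n (_≟ zero) vs)) ⟨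
  toℕ (zeros vs)             ≡⟨ toℕ-inject₁ (zeros vs) ⟨
  toℕ (inject₁ (zeros vs))   ∎)
  where open ≡-Reasoning

-- A tuple with exactly β zeros is given by the places of the zeros and one of n nonzero values at
-- each of the other k - β places. The induction on k runs through `binomialSum-suc`.
sumOver-zeros : ∀ n k (h : Fin (suc k) → ℕ) →
  sumOver (vectors k (allFin (suc n))) (h ∘ zeros) ≡ binomialSum n h
sumOver-zeros n zero    h = cong (ℕ._+ 0) (sym (trans (ℕ.*-identityˡ _) (ℕ.*-identityˡ _)))
sumOver-zeros n (suc k) h = begin
  sumOver (vectors (suc k) (allFin (suc n))) (h ∘ zeros)
    ≡⟨ sumOver-product _∷_ (allFin (suc n)) vss (h ∘ zeros) ⟩
  -- The head is either zero, where `zeros` computes to a successor, or one of n nonzero values,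
  -- where `zeros-suc` applies.
  sumOver vss (h ∘ suc ∘ zeros) + sumOver (List.tabulate suc) (λ i → sumOver vss (λ vs → h (zeros (i ∷ vs))))
    ≡⟨ cong₂ _+_ (sumOver-zeros n k (h ∘ suc))
         (sumOver-tabulate-const n suc _ (binomialSum n (h ∘ inject₁)) λ i →
           trans (sumOver-cong vss (λ vs → cong h (zeros-suc i vs))) (sumOver-zeros n k (h ∘ inject₁))) ⟩
  binomialSum n (h ∘ suc) + n * binomialSum n (h ∘ inject₁)
    ≡⟨ binomialSum-suc n h ⟨
  binomialSum n h ∎
  where
  open ≡-Reasoning
  vss = vectors k (allFin (suc n))

-- The recurrence over ℕ

-- Since c is 0 or 1, the coefficients c and 1 - c select the right indicator. In this form the
-- dependence on the last values sits in the coefficients alone and can be summed separately.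
boolToℕ-≟-+ : (w : ℕ) (c : Fin 2) (m : ℤ) →
  boolToℕ (does (+ (w + toℕ c) ℤ.≟ m ℤ.+ 1ℤ))
    ≡ toℕ c * boolToℕ (does (+ w ℤ.≟ m)) + (1 ∸ toℕ c) * boolToℕ (does (+ w ℤ.≟ m ℤ.+ 1ℤ))
boolToℕ-≟-+ w zero m rewrite ℕ.+-identityʳ w = sym (ℕ.+-identityʳ _)
boolToℕ-≟-+ w (suc zero) m = trans
  (cong boolToℕ (does-⇔ (mk⇔ (∙-cancelʳ 1ℤ _ _) (cong (ℤ._+ 1ℤ))) (+ w ℤ.+ 1ℤ ℤ.≟ m ℤ.+ 1ℤ) (+ w ℤ.≟ m)))
  (sym (trans (ℕ.+-identityʳ _) (ℕ.+-identityʳ _)))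

chosen unchosen : ∀ {k} → Vec (Fin 2) k → Fin k → ℕ
chosen   C β = toℕ (lookup C β)
unchosen C β = 1 ∸ toℕ (lookup C β)

O-suc : ∀ {k} (C : Vec (Fin 2) (suc k)) n (m : ℤ) →
  O C (suc n) (m ℤ.+ 1ℤ)
    ≡ binomialSum n (chosen C) * O C n m + binomialSum n (unchosen C) * O C n (m ℤ.+ 1ℤ)
O-suc {k} C n m = begin
  O C (suc n) (m ℤ.+ 1ℤ)
    ≡⟨ length-filter≡sumOver _ (tuples k (suc n)) ⟩
  sumOver (tuples k (suc n)) (hits (suc n) (m ℤ.+ 1ℤ))
    ≡⟨ sumOver-vectors-zipWith extend (permutations n) (allFin (suc n)) _ (permutations-suc-↭ n) k _ ⟩
  sumOver (tuples k n) (λ πs → sumOver vss λ vs → hits (suc n) (m ℤ.+ 1ℤ) (zipWith extend πs vs))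
    -- Membership in `tuples k n` supplies that all entries are permutations, which the level of the
    -- last position requires.
    ≡⟨ sumOver-cong-∈ (tuples k n) (λ {πs} πs∈ →
         trans (sumOver-cong vss (hits-extend πs∈)) (sum-choices (hits n m πs) (hits n (m ℤ.+ 1ℤ) πs))) ⟩
  sumOver (tuples k n) (λ πs →
    binomialSum n (chosen C) * hits n m πs + binomialSum n (unchosen C) * hits n (m ℤ.+ 1ℤ) πs)
    ≡⟨ sumOver-+ (tuples k n) _ _ ⟩
  sumOver (tuples k n) (λ πs → binomialSum n (chosen C) * hits n m πs)
    + sumOver (tuples k n) (λ πs → binomialSum n (unchosen C) * hits n (m ℤ.+ 1ℤ) πs)
    ≡⟨ cong₂ _+_ (scaled (chosen C) m) (scaled (unchosen C) (m ℤ.+ 1ℤ)) ⟩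
  binomialSum n (chosen C) * O C n m + binomialSum n (unchosen C) * O C n (m ℤ.+ 1ℤ) ∎
  where
  open ≡-Reasoning
  vss = vectors k (allFin (suc n))

  hits : ∀ n → ℤ → Vec (Vec (Fin n) n) k → ℕ
  hits n m πs = boolToℕ (does (+ weight C πs ℤ.≟ m))

  hits-extend : ∀ {πs} → πs ∈ tuples k n → ∀ vs → hits (suc n) (m ℤ.+ 1ℤ) (zipWith extend πs vs)
    ≡ chosen C (zeros vs) * hits n m πs + unchosen C (zeros vs) * hits n (m ℤ.+ 1ℤ) πs
  hits-extend {πs} πs∈ vs = trans
    (cong (λ w → boolToℕ (does (+ w ℤ.≟ m ℤ.+ 1ℤ)))
      (weight-extend C (VecAll.map ∈-permutations⁻ (∈-vectors⁻ k πs∈)) vs))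
    (boolToℕ-≟-+ (weight C πs) (lookup C (zeros vs)) m)

  sum-choices : ∀ a b →
    sumOver vss (λ vs → chosen C (zeros vs) * a + unchosen C (zeros vs) * b)
      ≡ binomialSum n (chosen C) * a + binomialSum n (unchosen C) * b
  sum-choices a b = trans (sumOver-+ vss _ _) (cong₂ _+_ (factor (chosen C) a) (factor (unchosen C) b))
    where
    factor : ∀ h a → sumOver vss (λ vs → h (zeros vs) * a) ≡ binomialSum n h * a
    factor h a = begin
      sumOver vss (λ vs → h (zeros vs) * a) ≡⟨ sumOver-cong vss (λ vs → ℕ.*-comm (h (zeros vs)) a) ⟩
      sumOver vss (λ vs → a * h (zeros vs)) ≡⟨ sumOver-*ˡ vss a (h ∘ zeros) ⟩
      a * sumOver vss (h ∘ zeros)           ≡⟨ cong (a ℕ.*_) (sumOver-zeros n k h) ⟩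
      a * binomialSum n h                   ≡⟨ ℕ.*-comm a _ ⟩
      binomialSum n h * a                   ∎

  scaled : ∀ h m → sumOver (tuples k n) (λ πs → binomialSum n h * hits n m πs) ≡ binomialSum n h * O C n m
  scaled h m = trans (sumOver-*ˡ (tuples k n) (binomialSum n h) (hits n m))
    (cong (binomialSum n h ℕ.*_) (sym (length-filter≡sumOver _ (tuples k n))))

-- Passage to ℚ

-- Sums of unnormalised fractions compute on numerators and denominators; this carries such
-- computations over to normalised rationals.
fromℚᵘ-homo-+ : ∀ p q → fromℚᵘ (p ℚᵘ.+ q) ≡ fromℚᵘ p ℚ.+ fromℚᵘ q
fromℚᵘ-homo-+ p q = ℚ.toℚᵘ-injective (begin
  toℚᵘ (fromℚᵘ (p ℚᵘ.+ q))               ≈⟨ ℚ.toℚᵘ-fromℚᵘ _ ⟩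
  p ℚᵘ.+ q                               ≈⟨ ℚᵘ.+-cong (ℚ.toℚᵘ-fromℚᵘ p) (ℚ.toℚᵘ-fromℚᵘ q) ⟨
  toℚᵘ (fromℚᵘ p) ℚᵘ.+ toℚᵘ (fromℚᵘ q)   ≈⟨ ℚ.toℚᵘ-homo-+ (fromℚᵘ p) (fromℚᵘ q) ⟨
  toℚᵘ (fromℚᵘ p ℚ.+ fromℚᵘ q)           ∎)
  where open import Relation.Binary.Reasoning.Setoid ℚᵘ.≃-setoid

fromℚᵘ-homo-* : ∀ p q → fromℚᵘ (p ℚᵘ.* q) ≡ fromℚᵘ p ℚ.* fromℚᵘ q
fromℚᵘ-homo-* p q = ℚ.toℚᵘ-injective (begin
  toℚᵘ (fromℚᵘ (p ℚᵘ.* q))               ≈⟨ ℚ.toℚᵘ-fromℚᵘ _ ⟩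
  p ℚᵘ.* q                               ≈⟨ ℚᵘ.*-cong (ℚ.toℚᵘ-fromℚᵘ p) (ℚ.toℚᵘ-fromℚᵘ q) ⟨
  toℚᵘ (fromℚᵘ p) ℚᵘ.* toℚᵘ (fromℚᵘ q)   ≈⟨ ℚ.toℚᵘ-homo-* (fromℚᵘ p) (fromℚᵘ q) ⟨
  toℚᵘ (fromℚᵘ p ℚ.* fromℚᵘ q)           ∎)
  where open import Relation.Binary.Reasoning.Setoid ℚᵘ.≃-setoid

fromNat-+ : ∀ i j → fromNat (i + j) ≡ fromNat i ℚ.+ fromNat j
fromNat-+ i j = trans
  -- The unnormalised sum of i/1 and j/1 has numerator i * 1 + j * 1.
  (cong (_/ 1) (sym (cong₂ ℤ._+_ (ℤ.*-identityʳ (+ i)) (ℤ.*-identityʳ (+ j)))))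
  (fromℚᵘ-homo-+ (mkℚᵘ (+ i) 0) (mkℚᵘ (+ j) 0))

fromNat-* : ∀ i j → fromNat (i * j) ≡ fromNat i ℚ.* fromNat j
fromNat-* i j = trans (cong (_/ 1) (ℤ.pos-* i j)) (fromℚᵘ-homo-* (mkℚᵘ (+ i) 0) (mkℚᵘ (+ j) 0))

fromNat-inverse : ∀ d .{{_ : NonZero d}} → fromNat d ℚ.* (+ 1 / d) ≡ 1ℚ
fromNat-inverse d@(suc d-1) = trans
  (sym (fromℚᵘ-homo-* (mkℚᵘ (+ d) 0) (mkℚᵘ (+ 1) d-1)))
  (ℚ.fromℚᵘ-cong {mkℚᵘ (+ d) 0 ℚᵘ.* mkℚᵘ (+ 1) d-1} {ℚᵘ.1ℚᵘ} (ℚᵘ.*-inverseʳ (mkℚᵘ (+ d) 0)))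

-- The terms of F are fractions and become natural numbers only after scaling, so the scalar is
-- distributed over the sum first.
fromNat-∑ : ∀ {k} (a : ℚ) (x : Fin k → ℚ) (y : Fin k → ℕ) →
  (∀ i → a ℚ.* x i ≡ fromNat (y i)) → a ℚ.* ∑ℚ x ≡ fromNat (∑ y)
fromNat-∑ {zero}  a x y eq = ℚ.*-zeroʳ a
fromNat-∑ {suc k} a x y eq = begin
  a ℚ.* (x zero ℚ.+ ∑ℚ (x ∘ suc))              ≡⟨ ℚ.*-distribˡ-+ a (x zero) _ ⟩
  a ℚ.* x zero ℚ.+ a ℚ.* ∑ℚ (x ∘ suc)
    ≡⟨ cong₂ ℚ._+_ (eq zero) (fromNat-∑ a (x ∘ suc) (y ∘ suc) (eq ∘ suc)) ⟩
  fromNat (y zero) ℚ.+ fromNat (∑ (y ∘ suc))   ≡⟨ fromNat-+ (y zero) _ ⟨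
  fromNat (y zero + ∑ (y ∘ suc))               ∎
  where open ≡-Reasoning

-- Writing n^k as n^(k-β) n^β clears the denominator n^β of each term of F, where j - 1 = n. Thus
-- `binomialSum` is the integral form of n^k F_{n+1}.
scaledF≡binomialSum : ∀ {k} n .{{_ : NonZero n}} (X : Vec ℚ (suc k)) (h : Fin (suc k) → ℕ) →
  (∀ β → lookup X β ≡ fromNat (h β)) →
  fromNat (n ^ k) ℚ.* F (suc n) X ≡ fromNat (binomialSum n h)
scaledF≡binomialSum {k} n X h X≗h = fromNat-∑ (fromNat (n ^ k)) _
  (λ β → (k choose toℕ β) * (n ^ (k ∸ toℕ β) * h β)) term
  where
  term : (β : Fin (suc k)) →
    let instance _ = ℕ.m^n≢0 n (toℕ β) in
    fromNat (n ^ k) ℚ.* (fromNat (k choose toℕ β) ℚ.* (lookup X β ℚ.* (+ 1 / (n ^ toℕ β))))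
      ≡ fromNat ((k choose toℕ β) * (n ^ (k ∸ toℕ β) * h β))
  term β = begin
    fromNat (n ^ k) ℚ.* (c ℚ.* (lookup X β ℚ.* i))
      ≡⟨ cong₂ (λ p x → p ℚ.* (c ℚ.* (x ℚ.* i))) power (X≗h β) ⟩
    (q ℚ.* p) ℚ.* (c ℚ.* (x ℚ.* i))
      ≡⟨ solve 5 (λ q p c x i → (q :* p) :* (c :* (x :* i)) := (c :* (q :* x)) :* (p :* i)) refl q p c x i ⟩
    (c ℚ.* (q ℚ.* x)) ℚ.* (p ℚ.* i)
      ≡⟨ cong ((c ℚ.* (q ℚ.* x)) ℚ.*_) (fromNat-inverse (n ^ toℕ β)) ⟩
    (c ℚ.* (q ℚ.* x)) ℚ.* 1ℚ
      ≡⟨ ℚ.*-identityʳ _ ⟩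
    c ℚ.* (q ℚ.* x)
      ≡⟨ cong (c ℚ.*_) (fromNat-* (n ^ (k ∸ toℕ β)) (h β)) ⟨
    c ℚ.* fromNat (n ^ (k ∸ toℕ β) * h β)
      ≡⟨ fromNat-* (k choose toℕ β) _ ⟨
    fromNat ((k choose toℕ β) * (n ^ (k ∸ toℕ β) * h β)) ∎
    where
    open ≡-Reasoning
    open ℚ-Solver
    instance _ = ℕ.m^n≢0 n (toℕ β)
    c = fromNat (k choose toℕ β)
    i = + 1 / (n ^ toℕ β)
    p = fromNat (n ^ toℕ β)
    q = fromNat (n ^ (k ∸ toℕ β))
    x = fromNat (h β)

    power : fromNat (n ^ k) ≡ q ℚ.* p
    power = begin
      fromNat (n ^ k)                          ≡⟨ cong (fromNat ∘ (n ^_)) (ℕ.m∸n+n≡m (toℕ≤pred[n] β)) ⟨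
      fromNat (n ^ (k ∸ toℕ β + toℕ β))        ≡⟨ cong fromNat (ℕ.^-distribˡ-+-* n (k ∸ toℕ β) (toℕ β)) ⟩
      fromNat (n ^ (k ∸ toℕ β) * n ^ toℕ β)    ≡⟨ fromNat-* (n ^ (k ∸ toℕ β)) _ ⟩
      q ℚ.* p                                  ∎

-- Truncated and rational subtraction agree because each entry is at most 1.
lookup-complement : ∀ {k} (C : Vec (Fin 2) k) β → lookup (complement C) β ≡ fromNat (unchosen C β)
lookup-complement (zero     ∷ C) zero    = refl
lookup-complement (suc zero ∷ C) zero    = refl
lookup-complement (_        ∷ C) (suc β) = lookup-complement C β

O-recurrence : ∀ {k} n .{{_ : NonZero n}} (C : Vec (Fin 2) (suc k)) (m : ℤ) →
  fromNat (O C (suc n) (m ℤ.+ 1ℤ))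
    ≡ fromNat (n ^ k) ℚ.* F (suc n) (toRational C) ℚ.* fromNat (O C n m)
      ℚ.+ fromNat (n ^ k) ℚ.* F (suc n) (complement C) ℚ.* fromNat (O C n (m ℤ.+ 1ℤ))
O-recurrence {k} n C m = begin
  fromNat (O C (suc n) (m ℤ.+ 1ℤ))
    ≡⟨ cong fromNat (O-suc C n m) ⟩
  fromNat (a * O C n m + b * O C n (m ℤ.+ 1ℤ))
    ≡⟨ fromNat-+ (a * O C n m) _ ⟩
  fromNat (a * O C n m) ℚ.+ fromNat (b * O C n (m ℤ.+ 1ℤ))
    ≡⟨ cong₂ ℚ._+_ (fromNat-* a (O C n m)) (fromNat-* b (O C n (m ℤ.+ 1ℤ))) ⟩
  fromNat a ℚ.* fromNat (O C n m) ℚ.+ fromNat b ℚ.* fromNat (O C n (m ℤ.+ 1ℤ))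
    ≡⟨ cong₂ (λ x y → x ℚ.* fromNat (O C n m) ℚ.+ y ℚ.* fromNat (O C n (m ℤ.+ 1ℤ)))
         (scaledF≡binomialSum n (toRational C) (chosen C) (λ β → Vec.lookup-map β _ C))
         (scaledF≡binomialSum n (complement C) (unchosen C) (lookup-complement C)) ⟨
  fromNat (n ^ k) ℚ.* F (suc n) (toRational C) ℚ.* fromNat (O C n m)
    ℚ.+ fromNat (n ^ k) ℚ.* F (suc n) (complement C) ℚ.* fromNat (O C n (m ℤ.+ 1ℤ)) ∎
  where
  open ≡-Reasoning
  a = binomialSum n (chosen C)
  b = binomialSum n (unchosen C)

-- Boundary values

-- The size is written as `suc n` so that a first position exists; the weight then lies between c_k
-- and c_k + n.
O-outside : ∀ {k} n (C : Vec (Fin 2) (suc k)) (m : ℤ) →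
  m ℤ.< lastCoordinate C ⊎ lastCoordinate C ℤ.+ + n ℤ.< m → O C (suc n) m ≡ 0
O-outside {k} n C m outside = cong length
  (List.filter-none (λ πs → + weight C πs ℤ.≟ m) (All.universal (weight≢ outside) (tuples k (suc n))))
  where
  weight≢ : m ℤ.< lastCoordinate C ⊎ lastCoordinate C ℤ.+ + n ℤ.< m → ∀ πs → + weight C πs ≢ m
  weight≢ (inj₁ m<) πs eq = ℤ.<⇒≱ m< (subst (lastCoordinate C ℤ.≤_) eq (ℤ.+≤+ (weight-≥ C πs)))
  weight≢ (inj₂ <m) πs eq = ℤ.<⇒≱ <m (subst (ℤ._≤ _) eq (ℤ.+≤+ (weight-≤ C πs)))

length-vectors-singleton : {A : Set} (x : A) (k : ℕ) → length (vectors k (x ∷ [])) ≡ 1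
length-vectors-singleton x zero    = refl
length-vectors-singleton x (suc k) = begin
  length (List.map (x ∷_) (vectors k (x ∷ [])) List.++ [])  ≡⟨ cong length (List.++-identityʳ (List.map (x ∷_) (vectors k (x ∷ [])))) ⟩
  length (List.map (x ∷_) (vectors k (x ∷ [])))             ≡⟨ List.length-map (x ∷_) (vectors k (x ∷ [])) ⟩
  length (vectors k (x ∷ []))                               ≡⟨ length-vectors-singleton x k ⟩
  1                                                         ∎
  where open ≡-Reasoning

-- A single position is a first position, so every tuple has weight c_k, and the only tuple repeats
-- the permutation `zero ∷ []`.
O-1-lastCoordinate : ∀ {k} (C : Vec (Fin 2) (suc k)) → O C 1 (lastCoordinate C) ≡ 1
O-1-lastCoordinate {k} C = trans
  (cong length (List.filter-all (λ πs → + weight C πs ℤ.≟ lastCoordinate C)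
    (All.universal (λ πs → cong +_ (trans (weight-first C πs) (ℕ.+-identityʳ _))) (tuples k 1))))
  (length-vectors-singleton (zero ∷ []) k)

theorem3p1 : (k n : ℕ) .{{_ : NonZero k}} .{{_ : NonZero n}} (C : Vec (Fin 2) (suc k)) →
    ((m : ℤ) → lastCoordinate C ℤ.- 1ℤ ℤ.≤ m →
    fromNat (O C (suc n) (m ℤ.+ 1ℤ))
    ≡ fromNat (n ^ k) ℚ.* F (suc n) (toRational C) ℚ.* fromNat (O C n m)
    ℚ.+ fromNat (n ^ k) ℚ.* F (suc n) (complement C) ℚ.* fromNat (O C n (m ℤ.+ 1ℤ)))
    × ((m : ℤ) → (m ≡ lastCoordinate C ℤ.- 1ℤ) ⊎ (lastCoordinate C ℤ.- 1ℤ ℤ.+ + n ℤ.< m) → O C n m ≡ 0)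
    × (O C 1 (lastCoordinate C) ≡ 1)
theorem3p1 k n@(suc n-1) C = (λ m _ → O-recurrence n C m) , boundary , O-1-lastCoordinate C
  where
  boundary : (m : ℤ) → (m ≡ lastCoordinate C ℤ.- 1ℤ) ⊎ (lastCoordinate C ℤ.- 1ℤ ℤ.+ + n ℤ.< m) → O C n m ≡ 0
  -- The predecessor of c_k is defined as -1 + c_k, hence the commutation.
  boundary m (inj₁ refl) = O-outside n-1 C m (inj₁ (ℤ.i≤pred[j]⇒i<j (ℤ.≤-reflexive (ℤ.+-comm (lastCoordinate C) (ℤ.- 1ℤ)))))
  -- After reassociation, -1 + n computes to `n-1`, so that the bound c_k - 1 + n becomes c_k +
  -- `n-1`.
  boundary m (inj₂ <m)   = O-outside n-1 C m (inj₂ (subst (ℤ._< m) (ℤ.+-assoc (lastCoordinate C) (ℤ.- 1ℤ) (+ n)) <m))
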